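{- Let $\Delta$ be a positive integer and let $G$ be a connected weighted triangle-free graph with weights $w:E(G)\to\mathbb{R}_+$ and maximum degree $\Delta(G)\le\Delta$. Then $\mathrm{mac}(G)\ge t_\Delta\, w(G)$, where $t_\Delta=\frac12+\frac{3\Delta-1}{4\Delta^2+2\Delta-2}$.
   Context: $\mathbb{R}_+$ denotes the non-negative reals; $w(G)$ is the sum of all edge weights. $\mathrm{mac}(G)$ is the maximum total weight of the edges between $A$ and $B$ over all partitions $(A,B)$ of $V(G)$. Triangle-free means containing no $K_3$ subgraph.
   Formalization: The edge weights are taken to be non-negative rational numbers instead of non-negative real numbers. -}

module Defs where

open import Data.Bool using (Bool; true; false; if_then_else_; _xor_; _∧_)
open import Data.Nat as ℕ using (ℕ; zero; suc; _<ᵇ_; NonZero)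
open import Data.Fin using (Fin; zero; suc; toℕ)
open import Data.Integer using (+_)
open import Data.Rational using (ℚ; 0ℚ; ½; _/_; _+_; _*_; _≤_; _⊔_)
open import Data.List using (List; []; _∷_; map; foldr; _++_)
open import Data.Product using (_×_; ∃)
open import Relation.Binary.PropositionalEquality using (_≡_)
open import Relation.Nullary using (¬_)

ΣQ : ∀ {n} → (Fin n → ℚ) → ℚ
ΣQ {zero}  f = 0ℚ
ΣQ {suc n} f = f zero + ΣQ (λ i → f (suc i))

count : ∀ {n} → (Fin n → Bool) → ℕ
count {zero}  p = 0
count {suc n} p = (if p zero then 1 else 0) ℕ.+ count (λ i → p (suc i))

record WGraph (n : ℕ) : Set where
  field
    adj    : Fin n → Fin n → Bool
    w      : Fin n → Fin n → ℚ
    irrefl : ∀ i → adj i i ≡ false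
    sym    : ∀ i j → adj i j ≡ adj j i
    wsym   : ∀ i j → w i j ≡ w j i
    wnonneg : ∀ i j → adj i j ≡ true → 0ℚ ≤ w i j
open WGraph public

edgeSum : ∀ {n} → WGraph n → (Fin n → Fin n → ℚ) → ℚ
edgeSum G f = ΣQ (λ i → ΣQ (λ j →
  if (toℕ i <ᵇ toℕ j) ∧ adj G i j then f i j else 0ℚ))

totalWeight : ∀ {n} → WGraph n → ℚ
totalWeight G = edgeSum G (w G)

-- A partition (A,B) of V(G) encoded by the characteristic function of A.
-- Weight of the cut: edges with endpoints on different sides.
cutWeight : ∀ {n} → WGraph n → (Fin n → Bool) → ℚ
cutWeight G A = edgeSum G (λ i j → if A i xor A j then w G i j else 0ℚ)

allParts : (n : ℕ) → List (Fin n → Bool)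
allParts zero = (λ ()) ∷ []
allParts (suc n) = map (λ A → ext false A) (allParts n) ++ map (λ A → ext true A) (allParts n)
  where
  ext : Bool → (Fin n → Bool) → Fin (suc n) → Bool
  ext b A zero = b
  ext b A (suc i) = A i

-- mac(G): maximum cut weight over all partitions (cut weights are ≥ 0,
-- so starting the fold at 0 is harmless).
mac : ∀ {n} → WGraph n → ℚ
mac {n} G = foldr _⊔_ 0ℚ (map (cutWeight G) (allParts n))

degree : ∀ {n} → WGraph n → Fin n → ℕ
degree G i = count (adj G i)

MaxDegreeAtMost : ∀ {n} → WGraph n → ℕ → Set
MaxDegreeAtMost G Δ = ∀ i → degree G i ℕ.≤ Δ

data Reach {n} (G : WGraph n) : Fin n → Fin n → Set where
  here : ∀ {i} → Reach G i i
  step : ∀ {i j k} → adj G i j ≡ true → Reach G j k → Reach G i k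

Connected : ∀ {n} → WGraph n → Set
Connected G = ∀ i j → Reach G i j

TriangleFree : ∀ {n} → WGraph n → Set
TriangleFree G = ∀ i j k → ¬ (adj G i j ≡ true × adj G j k ≡ true × adj G k i ≡ true)

-- t_Δ = 1/2 + (3Δ-1)/(4Δ²+2Δ-2) for Δ = suc k ≥ 1.
-- Denominator with Δ = suc k equals 4k²+10k+4 = suc (4k²+10k+3).
tDelta : (Δ : ℕ) → .{{NonZero Δ}} → ℚ
tDelta (suc k) = ½ + (+ (3 ℕ.* suc k ℕ.∸ 1)) / suc (4 ℕ.* k ℕ.* k ℕ.+ 10 ℕ.* k ℕ.+ 3)

{-# OPTIONS --safe #-}

-- Randomly flipping the blocks of a vertex partition whose blocks induce bipartite graphs cuts all edges inside the
-- blocks and half of the others in expectation, so mac(G) ≥ (w(G) + w(B)) / 2 for the set B of edges inside blocks.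
-- By Vizing's theorem the edges of G split into Δ + 1 matchings, and the heaviest one, M, has w(M) ≥ w(G) / (Δ + 1).
-- Contracting M leaves a simple graph of maximum degree at most 2Δ - 2, whose edges split into 2Δ - 1 matchings; the
-- heaviest of these joins the edges of M in pairs by edges of G of weight at least (w(G) - w(M)) / (2Δ - 1). Take as
-- blocks the pairs of joined edges of M: at most four vertices, bipartite because G is triangle-free.
--
-- Vizing's theorem is proved by adding a vertex x to a coloured graph, whose new edges get colours one at a time. The
-- fan of a neighbour y of x either ends in a colour unused at x, or returns to an earlier vertex z; in that case a
-- Kempe change away from z frees a colour at a vertex of the fan.
module Submission where

open import Defs hiding (sym)
open import Data.Bool using (Bool; true; false; not; if_then_else_; _xor_; _∧_)
import Data.Bool.Properties as Boolₚ
open import Data.Empty using (⊥-elim)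
open import Data.Fin using (Fin; zero; suc; toℕ; fromℕ<)
open import Data.Fin.Properties using (_≟_; any?; all?; ¬∀⟶∃¬; pigeonhole; toℕ-fromℕ<; toℕ<n; toℕ-injective)
import Data.Integer as ℤ
import Data.Integer.Properties as ℤₚ
open import Data.List using (List; []; _∷_; _++_; length; map; filter; foldr; allFin; lookup)
open import Data.List.Properties using (length-map; length-++; filter-notAll)
open import Data.List.Relation.Unary.All as All using (All; []; _∷_)
open import Data.List.Relation.Unary.All.Properties using (all-filter)
open import Data.List.Relation.Unary.Any as Any using (here; there; index)
open import Data.List.Relation.Unary.Any.Properties using (lookup-index)
open import Data.List.Membership.Propositional using (_∈_; _∉_)
open import Data.List.Membership.Propositional.Properties using (∈-map⁺; ∈-filter⁺; ∈-allFin; ∈-++⁺ˡ; ∈-++⁺ʳ)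
open import Data.Nat as ℕ using (ℕ; zero; suc; s≤s; z≤n; NonZero; _<ᵇ_)
import Data.Nat.Properties as ℕₚ
open import Data.Nat.Solver using () renaming (module +-*-Solver to ℕ-Solver)
open import Data.Product using (Σ; ∃; ∃₂; _×_; _,_; proj₁; proj₂)
open import Data.Rational as ℚ using (ℚ; 0ℚ; 1ℚ; ½; _/_; _+_; _*_; _≤_; _⊔_; fromℚᵘ; toℚᵘ)
import Data.Rational.Properties as ℚₚ
open import Data.Rational.Solver using (module +-*-Solver)
open import Data.Rational.Unnormalised as ℚᵘ using (mkℚᵘ; *≡*)
import Data.Rational.Unnormalised.Properties as ℚᵘₚ
open import Data.Sum using (_⊎_; inj₁; inj₂)
open import Function using (_∘_)
open import Relation.Nullary using (Dec; yes; no; ¬_; does; ¬?; _×-dec_; _⊎-dec_)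
open import Relation.Nullary.Decidable using (dec-true; dec-false)
open import Relation.Binary.PropositionalEquality

open ℕ-Solver using () renaming (_:+_ to _⊕_; _:*_ to _⊗_; _:=_ to _⊜_; con to lit)
open +-*-Solver using (solve; _:+_; _:*_; _:=_; con)

-- Decidable propositions and least witnesses

does⇒ : ∀ {A : Set} (A? : Dec A) → does A? ≡ true → A
does⇒ (yes a) _ = a

true⇔true⇒≡ : ∀ {x y} → (x ≡ true → y ≡ true) → (y ≡ true → x ≡ true) → x ≡ y
true⇔true⇒≡ {true}  {y}     f g = sym (f refl)
true⇔true⇒≡ {false} {true}  f g = g refl
true⇔true⇒≡ {false} {false} f g = refl

least : ∀ {P : ℕ → Set} → (∀ t → Dec (P t)) → ∀ l → P l → ∃ λ m → P m × (∀ t → t ℕ.< m → ¬ P t)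
least P? zero    p = zero , p , λ _ ()
least P? (suc l) p with P? 0
... | yes q = zero , q , λ _ ()
... | no ¬q with least (P? ∘ suc) l p
...   | m , r , small = suc m , r , λ { zero _ → ¬q ; (suc t) (s≤s lt) → small t lt }

-- Alternating walks of two involutions

module Walk {n : ℕ} (a b : Fin n → Fin n) (a-inv : ∀ v → a (a v) ≡ v) (b-inv : ∀ v → b (b v) ≡ v)
            (x : Fin n) (ax : a x ≡ x) where

  -- The walk from `x` begins with `b`, because `a` fixes `x`.
  turn : ℕ → Fin n → Fin n
  turn zero          = b
  turn (suc zero)    = a
  turn (suc (suc t)) = turn t

  pos : ℕ → Fin n
  pos zero    = x
  pos (suc t) = turn t (pos t)

  turn-inv : ∀ t v → turn t (turn t v) ≡ v
  turn-inv zero          = b-inv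
  turn-inv (suc zero)    = a-inv
  turn-inv (suc (suc t)) = turn-inv t

  turn-+2 : ∀ d i → turn (i ℕ.+ (d ℕ.+ d)) ≡ turn i
  turn-+2 zero    i = cong turn (ℕₚ.+-identityʳ i)
  turn-+2 (suc d) i = trans (cong turn lemma) (turn-+2 d i)
    where
    lemma : i ℕ.+ suc (d ℕ.+ suc d) ≡ suc (suc (i ℕ.+ (d ℕ.+ d)))
    lemma rewrite ℕₚ.+-suc d d | ℕₚ.+-suc i (suc (d ℕ.+ d)) | ℕₚ.+-suc i (d ℕ.+ d) = refl

  -- The walk retraces itself from an odd return, so it pauses halfway.
  odd-return : ∀ d i → pos i ≡ pos (suc (i ℕ.+ (d ℕ.+ d))) → ∃ λ l → pos l ≡ pos (suc l)
  odd-return zero    i eq = i , trans eq (cong (pos ∘ suc) (ℕₚ.+-identityʳ i))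
  odd-return (suc d) i eq = odd-return d (suc i) (begin
    turn i (pos i)                                            ≡⟨ cong (turn i) eq ⟩
    turn i (pos (suc (i ℕ.+ (suc d ℕ.+ suc d))))              ≡⟨⟩
    turn i (turn j (pos j))                                   ≡⟨ cong (λ f → f (turn j (pos j))) (sym (turn-+2 (suc d) i)) ⟩
    turn j (turn j (pos j))                                   ≡⟨ turn-inv j (pos j) ⟩
    pos j                                                     ≡⟨ cong pos (trans (cong (i ℕ.+_) (cong suc (ℕₚ.+-suc d d)))
                                                                   (trans (ℕₚ.+-suc i _) (cong suc (ℕₚ.+-suc i _)))) ⟩
    pos (suc (suc i ℕ.+ (d ℕ.+ d)))                           ∎)
    where
    open ≡-Reasoning
    j = i ℕ.+ (suc d ℕ.+ suc d)

  -- The steps into both positions apply the same involution, so the return can be traced back to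
  -- the start `x`. There `a x ≡ x` undoes the last step of the walk, which leaves an odd return to
  -- `x`.
  even-return : ∀ d i → pos i ≡ pos (i ℕ.+ (suc d ℕ.+ suc d)) → ∃ λ l → pos l ≡ pos (suc l)
  even-return d zero eq = odd-return d 0 (begin
    x                        ≡⟨ sym ax ⟩
    a x                      ≡⟨ cong a eq ⟩
    a (pos (suc d ℕ.+ suc d)) ≡⟨ cong (a ∘ pos) (cong suc (ℕₚ.+-suc d d)) ⟩
    a (turn (suc (d ℕ.+ d)) (pos (suc (d ℕ.+ d)))) ≡⟨ cong a (cong (λ f → f (pos (suc (d ℕ.+ d)))) (turn-+2 d 1)) ⟩
    a (a (pos (suc (d ℕ.+ d)))) ≡⟨ a-inv _ ⟩
    pos (suc (d ℕ.+ d))      ∎)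
    where open ≡-Reasoning
  even-return d (suc i) eq = even-return d i (begin
    pos i                    ≡⟨ sym (turn-inv i _) ⟩
    turn i (pos (suc i))     ≡⟨ cong (turn i) eq ⟩
    turn i (turn j (pos j))  ≡⟨ cong (λ f → f (turn j (pos j))) (sym (turn-+2 (suc d) i)) ⟩
    turn j (turn j (pos j))  ≡⟨ turn-inv j (pos j) ⟩
    pos j                    ∎)
    where
    open ≡-Reasoning
    j = i ℕ.+ (suc d ℕ.+ suc d)

  half : ∀ e → ∃ λ d → (e ≡ d ℕ.+ d) ⊎ (e ≡ suc (d ℕ.+ d))
  half zero = 0 , inj₁ refl
  half (suc e) with half e
  ... | d , inj₁ eq = d , inj₂ (cong suc eq)
  ... | d , inj₂ eq = suc d , inj₁ (trans (cong suc eq) (cong suc (sym (ℕₚ.+-suc d d))))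

  return : ∀ i e → pos i ≡ pos (i ℕ.+ suc e) → ∃ λ l → pos l ≡ pos (suc l)
  return i e eq with half e
  ... | d , inj₁ refl = odd-return d i (trans eq (cong pos (ℕₚ.+-suc i _)))
  ... | d , inj₂ refl = even-return d i (trans eq (cong (λ m → pos (i ℕ.+ suc m)) (sym (ℕₚ.+-suc d d))))

  -- Two of the first `suc n` positions coincide, and a return of either parity forces a pause.
  pauses : ∃ λ l → pos l ≡ pos (suc l)
  pauses with pigeonhole (ℕₚ.n<1+n n) (pos ∘ toℕ)
  ... | i , j , i<j , eq = return (toℕ i) (toℕ j ℕ.∸ suc (toℕ i))
        (trans eq (cong pos (sym (trans (ℕₚ.+-suc (toℕ i) _) (ℕₚ.m+[n∸m]≡n i<j)))))

  pause : ∃ λ m → pos m ≡ pos (suc m) × (∀ t → t ℕ.< m → ¬ pos t ≡ pos (suc t))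
  pause = least (λ t → pos t ≟ pos (suc t)) (proj₁ pauses) (proj₂ pauses)

-- Kempe components as alternating paths

module Component {n : ℕ} (a b : Fin n → Fin n) (a-inv : ∀ v → a (a v) ≡ v) (b-inv : ∀ v → b (b v) ≡ v)
                 (x : Fin n) (ax : a x ≡ x) (end : ℕ)
                 (end-stays : Walk.pos a b a-inv b-inv x ax end ≡ Walk.pos a b a-inv b-inv x ax (suc end))
                 (end-first : ∀ t → t ℕ.< end → ¬ Walk.pos a b a-inv b-inv x ax t ≡ Walk.pos a b a-inv b-inv x ax (suc t)) where
  open Walk a b a-inv b-inv x ax

  visited? : ∀ v → Dec (∃ λ (t : Fin (suc end)) → pos (toℕ t) ≡ v)
  visited? v = any? (λ t → pos (toℕ t) ≟ v)

  component : Fin n → Bool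
  component v = does (visited? v)

  visit : ∀ t → t ℕ.≤ end → component (pos t) ≡ true
  visit t t≤ = dec-true (visited? (pos t)) (fromℕ< (s≤s t≤) , cong pos (toℕ-fromℕ< (s≤s t≤)))

  visit-next : ∀ t → t ℕ.≤ end → component (pos (suc t)) ≡ true
  visit-next t t≤ with ℕₚ.m≤n⇒m<n∨m≡n t≤
  ... | inj₁ t< = visit (suc t) t<
  ... | inj₂ refl = trans (cong component (sym end-stays)) (visit t ℕₚ.≤-refl)

  -- Since `turn` has period two, `turn (suc t)` is also the involution that led to `pos t`, so it
  -- leads back; at the start it is `a`, which fixes `x`.
  visit-prev : ∀ t → t ℕ.≤ end → component (turn (suc t) (pos t)) ≡ true
  visit-prev zero    t≤ = trans (cong component ax) (visit 0 z≤n)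
  visit-prev (suc t) t≤ = trans (cong component (turn-inv t (pos t))) (visit t (ℕₚ.<⇒≤ t≤))

  data OneOf (f g : Fin n → Fin n) : Set where
    same : f ≡ a → g ≡ b → OneOf f g
    flip : f ≡ b → g ≡ a → OneOf f g

  turns : ∀ t → OneOf (turn (suc t)) (turn t)
  turns zero = same refl refl
  turns (suc zero) = flip refl refl
  turns (suc (suc t)) = turns t

  closed′ : ∀ t → t ℕ.≤ end → component (a (pos t)) ≡ true × component (b (pos t)) ≡ true
  closed′ t t≤ with turns t | visit-prev t t≤ | visit-next t t≤
  ... | same p q | u | v rewrite p | q = u , v
  ... | flip p q | u | v rewrite p | q = v , u

  closed-a : ∀ v → component (a v) ≡ component v
  closed-a v = true⇔true⇒≡ (λ e → trans (cong component (sym (a-inv v))) (to (a v) e)) (to v)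
    where
    to : ∀ u → component u ≡ true → component (a u) ≡ true
    to u e with does⇒ (visited? u) e
    ... | t , refl = proj₁ (closed′ (toℕ t) (ℕ.s≤s⁻¹ (toℕ<n t)))

  closed-b : ∀ v → component (b v) ≡ component v
  closed-b v = true⇔true⇒≡ (λ e → trans (cong component (sym (b-inv v))) (to (b v) e)) (to v)
    where
    to : ∀ u → component u ≡ true → component (b u) ≡ true
    to u e with does⇒ (visited? u) e
    ... | t , refl = proj₂ (closed′ (toℕ t) (ℕ.s≤s⁻¹ (toℕ<n t)))

  -- At every position after `x`, `a` is either the step in or the step out. If it fixes the
  -- position, the walk pauses one step before or right there, and the first pause is at `end`.
  endpoint : ∀ {y} → component y ≡ true → y ≢ x → a y ≡ y → y ≡ pos end
  endpoint {y} cy y≢x ay with does⇒ (visited? y) cy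
  ... | zero  , refl = ⊥-elim (y≢x refl)
  ... | suc t , refl with turns (toℕ t)
  ...   | flip p q = ⊥-elim (end-first (toℕ t) (toℕ<n t)
            (trans (sym (turn-inv (toℕ t) _)) (trans (cong (λ f → f (pos (suc (toℕ t)))) q) ay)))
  ...   | same p q with ℕₚ.m≤n⇒m<n∨m≡n (toℕ<n t)
  ...     | inj₁ lt = ⊥-elim (end-first (suc (toℕ t)) lt (sym (trans (cong (λ f → f (pos (suc (toℕ t)))) p) ay)))
  ...     | inj₂ eq = cong pos eq

  -- A component is a path with at most two endpoints, one of them x.
  other-endpoint-unique : ∀ {y z} → y ≢ x → z ≢ x → y ≢ z → a y ≡ y → a z ≡ z →
                          component y ≡ false ⊎ component z ≡ false
  other-endpoint-unique {y} {z} y≢x z≢x y≢z ay az with component y in cy | component z in cz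
  ... | false | _     = inj₁ refl
  ... | true  | false = inj₂ refl
  ... | true  | true  = ⊥-elim (y≢z (trans (endpoint cy y≢x ay) (sym (endpoint cz z≢x az))))

  component-root : component x ≡ true
  component-root = visit 0 z≤n

-- What the fan argument needs to know of a Kempe component, with the walk forgotten: `a` and `b`
-- will be the partner maps of two colours, the first of them missing at `x`.
record KempeSet {n : ℕ} (a b : Fin n → Fin n) (x : Fin n) : Set where
  field
    member   : Fin n → Bool
    closed-a : ∀ v → member (a v) ≡ member v
    closed-b : ∀ v → member (b v) ≡ member v
    root     : member x ≡ true
    unique   : ∀ {y z} → y ≢ x → z ≢ x → y ≢ z → a y ≡ y → a z ≡ z → member y ≡ false ⊎ member z ≡ false

kempeSet : ∀ {n} (a b : Fin n → Fin n) → (∀ v → a (a v) ≡ v) → (∀ v → b (b v) ≡ v) →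
           ∀ x → a x ≡ x → KempeSet a b x
kempeSet a b a-inv b-inv x ax with Walk.pause a b a-inv b-inv x ax
... | end , stays , first = record
  { member = component ; closed-a = closed-a ; closed-b = closed-b ; root = component-root ; unique = other-endpoint-unique }
  where open Component a b a-inv b-inv x ax end stays first

-- Finite graphs and proper edge colourings

module _ {n : ℕ} where
  open import Data.List.Membership.DecPropositional (_≟_ {n}) public using (_∈?_)

record Graph (n : ℕ) : Set₁ where
  field
    Edge       : Fin n → Fin n → Set
    edge?      : ∀ i j → Dec (Edge i j)
    edge-sym   : ∀ {i j} → Edge i j → Edge j i
    edge-irrefl : ∀ {i} → ¬ Edge i i

record Colouring {n : ℕ} (H : Graph n) (k : ℕ) : Set where
  open Graph H
  field
    colour     : Fin n → Fin n → Fin k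
    colour-sym : ∀ {i j} → Edge i j → colour i j ≡ colour j i
    proper     : ∀ {i j l} → Edge i j → Edge i l → colour i j ≡ colour i l → j ≡ l

  Missing : Fin k → Fin n → Set
  Missing γ i = ∀ j → Edge i j → colour i j ≢ γ

  partner? : ∀ γ i → Dec (∃ λ j → Edge i j × colour i j ≡ γ)
  partner? γ i = any? (λ j → edge? i j ×-dec (colour i j ≟ γ))

  abstract
    -- A colour class is a matching, here turned into an involution whose fixed points are the
    -- vertices at which `γ` is missing.
    partner : Fin k → Fin n → Fin n
    partner γ i with partner? γ i
    ... | yes (j , _) = j
    ... | no  _       = i

    partner-edge : ∀ {γ i j} → Edge i j → colour i j ≡ γ → partner γ i ≡ j
    partner-edge {γ} {i} {j} e c with partner? γ i
    ... | yes (l , e′ , c′) = proper e′ e (trans c′ (sym c))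
    ... | no  none          = ⊥-elim (none (j , e , c))

    partner-missing : ∀ {γ i} → Missing γ i → partner γ i ≡ i
    partner-missing {γ} {i} m with partner? γ i
    ... | yes (l , e , c) = ⊥-elim (m l e c)
    ... | no  _           = refl

    partner-cases : ∀ γ i → partner γ i ≡ i ⊎ (Edge i (partner γ i) × colour i (partner γ i) ≡ γ)
    partner-cases γ i with partner? γ i
    ... | yes (l , e , c) = inj₂ (e , c)
    ... | no  _           = inj₁ refl

  partner-involutive : ∀ γ i → partner γ (partner γ i) ≡ i
  partner-involutive γ i with partner-cases γ i
  ... | inj₁ eq      = trans (cong (partner γ) eq) eq
  ... | inj₂ (e , c) = partner-edge (edge-sym e) (trans (sym (colour-sym e)) c)

-- If every colour occurred in `cs`, then two of them would share a position there by the pigeonhole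
-- principle.
avoid : ∀ {k} (cs : List (Fin k)) → length cs ℕ.< k → ∃ λ α → α ∉ cs
avoid {k} cs short with all? (_∈? cs)
... | no ¬all = ¬∀⟶∃¬ k (_∈ cs) (_∈? cs) ¬all
... | yes all with pigeonhole short (λ α → index (all α))
...   | α , β , α<β , eq = ⊥-elim (ℕₚ.<-irrefl (cong toℕ α≡β) α<β)
  where
  α≡β : α ≡ β
  α≡β = trans (lookup-index (all α)) (trans (cong (lookup cs) eq) (sym (lookup-index (all β))))

-- Kempe changes

module Swap {k : ℕ} (α β : Fin k) where

  swap : Fin k → Fin k
  swap γ with γ ≟ α | γ ≟ β
  ... | yes _ | _     = β
  ... | no  _ | yes _ = α
  ... | no  _ | no  _ = γ

  swap-α : swap α ≡ β
  swap-α with α ≟ α | α ≟ β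
  ... | yes _ | _ = refl
  ... | no ¬p | _ = ⊥-elim (¬p refl)

  swap-β : swap β ≡ α
  swap-β with β ≟ α | β ≟ β
  ... | yes p | _ = p
  ... | no _ | yes _ = refl
  ... | no _ | no ¬p = ⊥-elim (¬p refl)

  swap-other : ∀ {γ} → γ ≢ α → γ ≢ β → swap γ ≡ γ
  swap-other {γ} γ≢α γ≢β with γ ≟ α | γ ≟ β
  ... | yes p | _     = ⊥-elim (γ≢α p)
  ... | no  _ | yes p = ⊥-elim (γ≢β p)
  ... | no  _ | no  _ = refl

  swap-involutive : ∀ γ → swap (swap γ) ≡ γ
  swap-involutive γ with γ ≟ α | γ ≟ β
  ... | yes refl | _        = swap-β
  ... | no  _    | yes refl = swap-α
  ... | no  p    | no  q    = swap-other p q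

  swap-injective : ∀ {γ δ} → swap γ ≡ swap δ → γ ≡ δ
  swap-injective {γ} {δ} eq = trans (sym (swap-involutive γ)) (trans (cong swap eq) (swap-involutive δ))

  swapIf : Bool → Fin k → Fin k
  swapIf true  = swap
  swapIf false = λ γ → γ

  swapIf-injective : ∀ s {γ δ} → swapIf s γ ≡ swapIf s δ → γ ≡ δ
  swapIf-injective true  = swap-injective
  swapIf-injective false = λ eq → eq

  swapIf-other : ∀ s {γ} → γ ≢ α → γ ≢ β → swapIf s γ ≡ γ
  swapIf-other true  = swap-other
  swapIf-other false = λ _ _ → refl

module Recolour {n k : ℕ} {H : Graph n} (C : Colouring H k) (α β : Fin k) (s : Fin n → Bool)
                (s-α : ∀ v → s (Colouring.partner C α v) ≡ s v)
                (s-β : ∀ v → s (Colouring.partner C β v) ≡ s v) where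
  open Graph H
  open Colouring C
  open Swap α β

  recolour : Colouring H k
  recolour = record
    { colour     = λ i j → swapIf (s i) (colour i j)
    ; colour-sym = λ {i} {j} e → csym i j e
    ; proper     = λ {i} e e′ eq → proper e e′ (swapIf-injective (s i) eq)
    }
    where
    -- An edge coloured `α` or `β` joins partners, so `s` agrees at its ends; every other colour is
    -- fixed by the swap.
    csym : ∀ i j → Edge i j → swapIf (s i) (colour i j) ≡ swapIf (s j) (colour j i)
    csym i j e rewrite sym (colour-sym e) with colour i j ≟ α | colour i j ≟ β
    ... | yes p | _     = cong (λ b → swapIf b (colour i j)) (trans (sym (s-α i)) (cong s (partner-edge e p)))
    ... | no  _ | yes p = cong (λ b → swapIf b (colour i j)) (trans (sym (s-β i)) (cong s (partner-edge e p)))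
    ... | no  p | no  q = trans (swapIf-other (s i) p q) (sym (swapIf-other (s j) p q))

  open Colouring recolour using () renaming (Missing to Missing′)

  missing-outside : ∀ {γ i} → s i ≡ false → Missing γ i → Missing′ γ i
  missing-outside {γ} {i} si m j e eq rewrite si = m j e eq

  missing-other : ∀ {γ i} → γ ≢ α → γ ≢ β → Missing γ i → Missing′ γ i
  missing-other {γ} {i} γ≢α γ≢β m j e eq =
    m j e (swapIf-injective (s i) (trans eq (sym (swapIf-other (s i) γ≢α γ≢β))))

  missing-inside : ∀ {i} → s i ≡ true → Missing α i → Missing′ β i
  missing-inside {i} si m j e eq rewrite si = m j e (swap-injective (trans eq (sym swap-α)))

-- Vizing fans

_[_≔_] : ∀ {n} {A : Set} → (Fin n → A) → Fin n → A → Fin n → A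
(c [ z ≔ β ]) i with i ≟ z
... | yes _ = β
... | no  _ = c i

≔-here : ∀ {n} {A : Set} (c : Fin n → A) z β → (c [ z ≔ β ]) z ≡ β
≔-here c z β with z ≟ z
... | yes _ = refl
... | no ¬p = ⊥-elim (¬p refl)

≔-there : ∀ {n} {A : Set} (c : Fin n → A) z β {i} → i ≢ z → (c [ z ≔ β ]) i ≡ c i
≔-there c z β {i} i≢z with i ≟ z
... | yes p = ⊥-elim (i≢z p)
... | no  _ = refl

-- An assignment records the colours to be given to the edges from a new vertex to the vertices in L.
record Assignment {n k : ℕ} {H : Graph n} (C : Colouring H k) (L : List (Fin n)) (c : Fin n → Fin k) : Set where
  open Colouring C
  field
    valid    : ∀ {i} → i ∈ L → Missing (c i) i
    distinct : ∀ {i j} → i ∈ L → j ∈ L → c i ≡ c j → i ≡ j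

-- The colouring of `H` belongs to the data because Kempe changes alter it.
Extension : ∀ {n} → Graph n → ℕ → List (Fin n) → Set
Extension H k L = Σ (Colouring H k) λ C → ∃ (Assignment C L)

module Fans {n k : ℕ} {H : Graph n} (L : List (Fin n)) (y : Fin n) (y∉L : y ∉ L) where
  open Colouring using (Missing; partner; partner-missing; partner-involutive)
  open Assignment

  -- A Vizing fan at the new vertex, with tip `v` and the earlier vertices listed backwards to `y`.
  -- The colour assigned to each vertex after `y` is missing at the vertex before it, so colours can
  -- be shifted towards `y`.
  data Fan (C : Colouring H k) (c : Fin n → Fin k) : List (Fin n) → Fin n → Set where
    start : Fan C c [] y
    grow  : ∀ {us v z} → Fan C c us v → z ∈ L → z ∉ v ∷ us → Missing C (c z) v → Fan C c (v ∷ us) z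

  fan-cong : ∀ {C c c′ us v} → (∀ {u} → u ∈ v ∷ us → c′ u ≡ c u) → Fan C c us v → Fan C c′ us v
  fan-cong eq start = start
  fan-cong {C} eq (grow {v = v} f z∈L fresh m) =
    grow (fan-cong (eq ∘ there) f) z∈L fresh (subst (λ γ → Missing C γ v) (sym (eq (here refl))) m)

  tip-fresh : ∀ {C c us v} → Fan C c us v → v ∉ us
  tip-fresh start ()
  tip-fresh (grow _ _ fresh _) = fresh

  -- Giving `β` to the tip releases its old colour, which is missing at the vertex before and, by
  -- distinctness, assigned to no other vertex. Repeating this down the fan supplies a colour for
  -- `y`.
  rotate : ∀ us {C c v β} → Assignment C L c → Fan C c us v → (∀ {i} → i ∈ L → c i ≢ β) → Missing C β v →
           Extension H k (y ∷ L)
  rotate [] {C} {c} {β = β} A start free m = C , c [ y ≔ β ] , record { valid = val ; distinct = dis }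
    where
    other : ∀ {i} → i ∈ L → (c [ y ≔ β ]) i ≡ c i
    other i∈L = ≔-there c y β (λ { refl → y∉L i∈L })
    val : ∀ {i} → i ∈ y ∷ L → Missing C ((c [ y ≔ β ]) i) i
    val (here refl) rewrite ≔-here c y β = m
    val (there i∈L) rewrite other i∈L = valid A i∈L
    dis : ∀ {i j} → i ∈ y ∷ L → j ∈ y ∷ L → (c [ y ≔ β ]) i ≡ (c [ y ≔ β ]) j → i ≡ j
    dis (here refl) (here refl) eq = refl
    dis (here refl) (there j∈L) eq = ⊥-elim (free j∈L (trans (sym (other j∈L)) (trans (sym eq) (≔-here c y β))))
    dis (there i∈L) (here refl) eq = ⊥-elim (free i∈L (trans (sym (other i∈L)) (trans eq (≔-here c y β))))
    dis (there i∈L) (there j∈L) eq = distinct A i∈L j∈L (trans (sym (other i∈L)) (trans eq (other j∈L)))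
  rotate (v ∷ us) {C} {c} {z} {β} A (grow f z∈L fresh mv) free m =
    rotate us record { valid = val ; distinct = dis } (fan-cong (λ u∈ → ≔-there c z β (λ { refl → fresh u∈ })) f) free′ mv
    where
    c′ = c [ z ≔ β ]
    val : ∀ {i} → i ∈ L → Missing C (c′ i) i
    val {i} i∈L with i ≟ z
    ... | yes refl = m
    ... | no  _    = valid A i∈L
    dis : ∀ {i j} → i ∈ L → j ∈ L → c′ i ≡ c′ j → i ≡ j
    dis {i} {j} i∈L j∈L eq with i ≟ z | j ≟ z
    ... | yes refl | yes refl = refl
    ... | yes refl | no _     = ⊥-elim (free j∈L (sym eq))
    ... | no _     | yes refl = ⊥-elim (free i∈L eq)
    ... | no _     | no _     = distinct A i∈L j∈L eq
    free′ : ∀ {i} → i ∈ L → c′ i ≢ c z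
    free′ {i} i∈L eq with i ≟ z
    ... | yes refl = free z∈L (sym eq)
    ... | no  i≢z  = i≢z (distinct A i∈L z∈L eq)

  -- As `z ∈ L` and `y ∉ L`, the vertex `z` is not the start of the fan, so it was added by `grow`
  -- on top of some `v′`.
  predecessor : ∀ {C c us v z} → Fan C c us v → z ∈ L → z ∈ v ∷ us →
                ∃₂ λ us′ v′ → Fan C c us′ v′ × Missing C (c z) v′ × v′ ∈ us × v′ ≢ z
  predecessor start z∈L (here refl) = ⊥-elim (y∉L z∈L)
  predecessor (grow {us} {v} f _ fresh m) _ (here refl) =
    us , v , f , m , here refl , λ { refl → fresh (here refl) }
  predecessor (grow f _ _ _) z∈L (there z∈) with predecessor f z∈L z∈
  ... | us′ , v′ , f′ , m′ , v′∈ , v′≢z = us′ , v′ , f′ , m′ , there v′∈ , v′≢z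

  -- The tip v, the vertex z and its predecessor v′ in the fan all miss α = c z, and the (α, β)-Kempe component of z
  -- contains at most one of v and v′. Recolouring the complement of that component preserves the colour assigned
  -- to z and makes β available at v or v′.
  module Close (C : Colouring H k) (c : Fin n → Fin k) (A : Assignment C L c)
               (β : Fin k) (free : ∀ {i} → i ∈ L → c i ≢ β) (z : Fin n) (z∈L : z ∈ L) where

    α : Fin k
    α = c z

    module _ (K : KempeSet (partner C α) (partner C β) z) where
      open KempeSet K
      open Recolour C α β (not ∘ member) (cong not ∘ closed-a) (cong not ∘ closed-b)

      missing-kept : ∀ {i u} → i ∈ L → c i ≢ α → Missing C (c i) u → Missing recolour (c i) u
      missing-kept i∈L ci≢α m = missing-other ci≢α (free i∈L) m

      -- By distinctness only `z` is assigned `α`, and it lies in the component, where nothing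
      -- changes; `β` is assigned to no vertex of `L`.
      assignment : Assignment recolour L c
      assignment = record { valid = val ; distinct = distinct A }
        where
        val : ∀ {i} → i ∈ L → Missing recolour (c i) i
        val {i} i∈L with c i ≟ α
        ... | no  p = missing-kept i∈L p (valid A i∈L)
        ... | yes p with distinct A i∈L z∈L p
        ...   | refl = missing-outside (cong not root) (valid A i∈L)

      -- A fan survives the recolouring up to the first vertex at which β has become available.
      transport : ∀ {us v} → Fan C c us v →
                  Fan recolour c us v ⊎ ∃₂ λ us′ v′ → Fan recolour c us′ v′ × Missing recolour β v′
      transport start = inj₁ start
      transport (grow {us} {v} {z′} f z′∈L fresh m) with transport f
      ... | inj₂ r  = inj₂ r
      ... | inj₁ f′ with c z′ ≟ α
      ...   | no p = inj₁ (grow f′ z′∈L fresh (missing-kept z′∈L p m))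
      ...   | yes p with member v in mv
      ...     | true  = inj₁ (grow f′ z′∈L fresh (missing-outside (cong not mv) m))
      ...     | false = inj₂ (us , v , f′ , missing-inside (cong not mv) (subst (λ γ → Missing C γ v) p m))

      rotate-outside : ∀ {us v} → Fan C c us v → Missing C α v → member v ≡ false → Extension H k (y ∷ L)
      rotate-outside {us} f m mv with transport f
      ... | inj₁ f′               = rotate us assignment f′ free (missing-inside (cong not mv) m)
      ... | inj₂ (us′ , v′ , f′ , m′) = rotate us′ assignment f′ free m′

    close : ∀ {us v} → Fan C c us v → z ∈ us → Missing C α v → Extension H k (y ∷ L)
    close {us} {v} f z∈us m with predecessor f z∈L (there z∈us)
    ... | us′ , v′ , f′ , m′ , v′∈us , v′≢z
      with kempeSet (partner C α) (partner C β) (partner-involutive C α) (partner-involutive C β) z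
                    (partner-missing C (valid A z∈L))
    ...   | K with KempeSet.unique K {v} {v′} (λ { refl → tip-fresh f z∈us }) v′≢z (λ { refl → tip-fresh f v′∈us })
                     (partner-missing C m) (partner-missing C m′)
    ...     | inj₁ out = rotate-outside K f m out
    ...     | inj₂ out = rotate-outside K f′ m′ out

  module Search (C : Colouring H k) (c : Fin n → Fin k) (A : Assignment C L c)
                (β : Fin k) (free : ∀ {i} → i ∈ L → c i ≢ β)
                (spare : ∀ {i} → i ∈ y ∷ L → ∃ λ α → Missing C α i × α ≢ c i) where

    tip∈ : ∀ {us v} → Fan C c us v → v ∈ y ∷ L
    tip∈ start = here refl
    tip∈ (grow _ z∈L _ _) = there z∈L

    -- The colour `α` missing at the tip is either unassigned, or assigned to a vertex already in
    -- the fan, or the fan grows. The list `R` covers the vertices of `L` outside the fan and loses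
    -- one at each growth, which bounds the recursion.
    search : ∀ fuel R → length R ℕ.≤ fuel → ∀ {us v} → Fan C c us v →
             (∀ {z} → z ∈ L → z ∉ v ∷ us → z ∈ R) → Extension H k (y ∷ L)
    search fuel R R≤ {us} {v} f cover with spare (tip∈ f)
    ... | α , m , α≢cv with any? (λ z → (z ∈? L) ×-dec (c z ≟ α))
    ...   | no unused = rotate us A f (λ i∈L eq → unused (_ , i∈L , eq)) m
    ...   | yes (z , z∈L , refl) with z ∈? us
    ...     | yes z∈us = Close.close C c A β free z z∈L f z∈us m
    ...     | no  z∉us = next fuel R≤
      where
      fresh : z ∉ v ∷ us
      -- The choice of `α` different from `c v` keeps the tip from following itself.
      fresh (here refl) = α≢cv refl
      fresh (there p)   = z∉us p
      smaller : length (filter (λ u → ¬? (u ≟ z)) R) ℕ.< length R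
      smaller = filter-notAll (λ u → ¬? (u ≟ z)) R (Any.map (λ { refl ¬p → ¬p refl }) (cover z∈L fresh))
      next : ∀ fuel → length R ℕ.≤ fuel → Extension H k (y ∷ L)
      next zero       R≤ = ⊥-elim (ℕₚ.n≮0 (ℕₚ.<-≤-trans smaller R≤))
      next (suc fuel) R≤ = search fuel (filter (λ u → ¬? (u ≟ z)) R) (ℕ.s≤s⁻¹ (ℕₚ.<-≤-trans smaller R≤))
        (grow f z∈L fresh m)
        (λ u∈L u∉ → ∈-filter⁺ (λ u → ¬? (u ≟ z)) (cover u∈L (u∉ ∘ there)) (λ { refl → u∉ (here refl) }))

    extend : Extension H k (y ∷ L)
    extend = search (length L) L ℕₚ.≤-refl start (λ z∈L _ → z∈L)

-- Vizing's theorem by adding one vertex at a time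

DegreeAtMost : ∀ {n} → Graph n → ℕ → Set
DegreeAtMost {n} H d = ∀ i → ∃ λ (ns : List (Fin n)) → length ns ℕ.≤ d × (∀ {j} → Graph.Edge H i j → j ∈ ns)

deleteZero : ∀ {n} → Graph (suc n) → Graph n
deleteZero H = record
  { Edge        = λ i j → Edge (suc i) (suc j)
  ; edge?       = λ i j → edge? (suc i) (suc j)
  ; edge-sym    = edge-sym
  ; edge-irrefl = edge-irrefl
  }
  where open Graph H

dropZero : ∀ {n} → List (Fin (suc n)) → List (Fin n)
dropZero []            = []
dropZero (zero  ∷ ns)  = dropZero ns
dropZero (suc i ∷ ns)  = i ∷ dropZero ns

length-dropZero : ∀ {n} (ns : List (Fin (suc n))) → length (dropZero ns) ℕ.≤ length ns
length-dropZero []           = z≤n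
length-dropZero (zero  ∷ ns) = ℕₚ.m≤n⇒m≤1+n (length-dropZero ns)
length-dropZero (suc i ∷ ns) = s≤s (length-dropZero ns)

∈-dropZero : ∀ {n} {i : Fin n} ns → suc i ∈ ns → i ∈ dropZero ns
∈-dropZero (zero  ∷ ns) (there p)   = ∈-dropZero ns p
∈-dropZero (suc i ∷ ns) (here refl) = here refl
∈-dropZero (suc i ∷ ns) (there p)   = there (∈-dropZero ns p)

module AddVertex {n d : ℕ} (H : Graph (suc n)) (deg : DegreeAtMost H d) where
  open Graph H
  open Colouring using (Missing; colour; colour-sym; proper)

  Neighbour : Fin n → Set
  Neighbour i = Edge zero (suc i)

  around : ∀ {A : Set} → A → (Fin n → A) → Fin (suc n) → A
  around x f zero    = x
  around x f (suc j) = f j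

  avoidAround : ∀ i (f : Fin (suc n) → Fin (suc d)) → ∃ λ α → ∀ {j} → Edge i j → α ≢ f j
  avoidAround i f with deg i
  ... | ns , ns≤ , cover with avoid (map f ns) (s≤s (subst (ℕ._≤ d) (sym (length-map f ns)) ns≤))
  ...   | α , α∉ = α , λ e eq → α∉ (subst (_∈ map f ns) (sym eq) (∈-map⁺ f (cover e)))

  -- In `H` the vertex `suc i` has at most `d` neighbours, `zero` among them; the edge to `zero` is
  -- counted with its intended colour `c i`. One of the `suc d` colours is left over.
  spare : ∀ (C : Colouring (deleteZero H) (suc d)) (c : Fin n → Fin (suc d)) i → Neighbour i → ∃ λ α → Missing C α i × α ≢ c i
  spare C c i e with avoidAround (suc i) (around (c i) (colour C i))
  ... | α , α≢ = α , (λ j e′ eq → α≢ e′ (sym eq)) , α≢ (edge-sym e)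

  extendAll : Colouring (deleteZero H) (suc d) → ∀ L → All Neighbour L → Extension (deleteZero H) (suc d) L
  extendAll C [] [] = C , (λ _ → zero) , record { valid = λ () ; distinct = λ () }
  extendAll C (y ∷ L) (e ∷ es) with extendAll C L es | y ∈? L
  ... | C′ , c , A | yes y∈L = C′ , c , record
    { valid    = λ p → valid (into p)
    ; distinct = λ p p′ → distinct (into p) (into p′)
    }
    where
    open Assignment A
    into : ∀ {i} → i ∈ y ∷ L → i ∈ L
    into (here refl) = y∈L
    into (there p)   = p
  -- The new vertex has at most `d` neighbours, so some colour `β` is assigned to none of them.
  ... | C′ , c , A | no y∉L with avoidAround zero (around zero c)
  ...   | β , β≢ = Fans.Search.extend L y y∉L C′ c A β (λ i∈L eq → β≢ (All.lookup es i∈L) (sym eq))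
                     (λ {i} i∈ → spare C′ c i (All.lookup (e ∷ es) i∈))

  neighbours : List (Fin n)
  neighbours = filter (λ i → edge? zero (suc i)) (allFin n)

  addVertex : Colouring (deleteZero H) (suc d) → Colouring H (suc d)
  addVertex C₀ with extendAll C₀ neighbours (all-filter (λ i → edge? zero (suc i)) (allFin n))
  ... | C , c , A = record { colour = col ; colour-sym = λ {i} {j} → col-sym i j ; proper = λ {i} {j} {l} → col-proper i j l }
    where
    open Assignment A
    nb : ∀ {i} → Neighbour i → i ∈ neighbours
    nb e = ∈-filter⁺ (λ i → edge? zero (suc i)) (∈-allFin _) e
    col : Fin (suc n) → Fin (suc n) → Fin (suc d)
    col zero    zero    = zero
    col zero    (suc j) = c j
    col (suc i) zero    = c i
    col (suc i) (suc j) = colour C i j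
    col-sym : ∀ i j → Edge i j → col i j ≡ col j i
    col-sym zero    zero    e = refl
    col-sym zero    (suc j) e = refl
    col-sym (suc i) zero    e = refl
    col-sym (suc i) (suc j) e = colour-sym C e
    col-proper : ∀ i j l → Edge i j → Edge i l → col i j ≡ col i l → j ≡ l
    col-proper zero zero _ e e′ eq = ⊥-elim (edge-irrefl e)
    col-proper zero (suc _) zero e e′ eq = ⊥-elim (edge-irrefl e′)
    col-proper zero (suc j) (suc l) e e′ eq = cong suc (distinct (nb e) (nb e′) eq)
    col-proper (suc i) zero zero e e′ eq = refl
    col-proper (suc i) zero (suc l) e e′ eq = ⊥-elim (valid (nb (edge-sym e)) l e′ (sym eq))
    col-proper (suc i) (suc j) zero e e′ eq = ⊥-elim (valid (nb (edge-sym e′)) j e eq)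
    col-proper (suc i) (suc j) (suc l) e e′ eq = cong suc (proper C e e′ eq)

vizing : ∀ {n d} (H : Graph n) → DegreeAtMost H d → Colouring H (suc d)
vizing {zero} H deg = record { colour = λ () ; colour-sym = λ { {()} } ; proper = λ { {()} } }
vizing {suc n} {d} H deg = AddVertex.addVertex H deg (vizing (deleteZero H) deg′)
  where
  deg′ : DegreeAtMost (deleteZero H) d
  deg′ i with deg (suc i)
  ... | ns , ns≤ , cover = dropZero ns , ℕₚ.≤-trans (length-dropZero ns) ns≤ , λ e → ∈-dropZero ns (cover e)

-- Sums over vertices and edges

when : Bool → ℚ → ℚ
when b x = if b then x else 0ℚ

ΣQ-cong : ∀ {n} {f g : Fin n → ℚ} → (∀ i → f i ≡ g i) → ΣQ f ≡ ΣQ g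
ΣQ-cong {zero}  eq = refl
ΣQ-cong {suc n} eq = cong₂ _+_ (eq zero) (ΣQ-cong (eq ∘ suc))

ΣQ-mono : ∀ {n} {f g : Fin n → ℚ} → (∀ i → f i ≤ g i) → ΣQ f ≤ ΣQ g
ΣQ-mono {zero}  le = ℚₚ.≤-refl
ΣQ-mono {suc n} le = ℚₚ.+-mono-≤ (le zero) (ΣQ-mono (le ∘ suc))

ΣQ-0 : ∀ n → ΣQ {n} (λ _ → 0ℚ) ≡ 0ℚ
ΣQ-0 zero    = refl
ΣQ-0 (suc n) = trans (ℚₚ.+-identityˡ _) (ΣQ-0 n)

ΣQ-+ : ∀ {n} (f g : Fin n → ℚ) → ΣQ (λ i → f i + g i) ≡ ΣQ f + ΣQ g
ΣQ-+ {zero}  f g = refl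
ΣQ-+ {suc n} f g = trans (cong ((f zero + g zero) +_) (ΣQ-+ (f ∘ suc) (g ∘ suc)))
  (solve 4 (λ a b c d → (a :+ b) :+ (c :+ d) := (a :+ c) :+ (b :+ d)) refl
    (f zero) (g zero) (ΣQ (f ∘ suc)) (ΣQ (g ∘ suc)))

ΣQ-* : ∀ {n} c (f : Fin n → ℚ) → ΣQ (λ i → c * f i) ≡ c * ΣQ f
ΣQ-* {zero}  c f = sym (ℚₚ.*-zeroʳ c)
ΣQ-* {suc n} c f = trans (cong (c * f zero +_) (ΣQ-* c (f ∘ suc))) (sym (ℚₚ.*-distribˡ-+ c (f zero) (ΣQ (f ∘ suc))))

ΣQ-swap : ∀ {m n} (f : Fin m → Fin n → ℚ) → ΣQ (λ i → ΣQ (f i)) ≡ ΣQ (λ j → ΣQ (λ i → f i j))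
ΣQ-swap {zero}  {n} f = sym (ΣQ-0 n)
ΣQ-swap {suc m} f = trans (cong (ΣQ (f zero) +_) (ΣQ-swap (f ∘ suc))) (sym (ΣQ-+ (f zero) _))

ΣQ-indicator : ∀ {n} (i : Fin n) x → ΣQ (λ j → when (does (i ≟ j)) x) ≡ x
ΣQ-indicator {suc n} zero x = trans (cong (x +_) (ΣQ-0 n)) (ℚₚ.+-identityʳ x)
ΣQ-indicator (suc i) x = trans (ℚₚ.+-identityˡ _) (ΣQ-indicator i x)

when-+ : ∀ b x y → when b (x + y) ≡ when b x + when b y
when-+ true  x y = refl
when-+ false x y = refl

when-* : ∀ b c x → when b (c * x) ≡ c * when b x
when-* true  c x = refl
when-* false c x = sym (ℚₚ.*-zeroʳ c)

when-ΣQ : ∀ {n} b (f : Fin n → ℚ) → when b (ΣQ f) ≡ ΣQ (λ i → when b (f i))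
when-ΣQ true  f = refl
when-ΣQ {n} false f = sym (ΣQ-0 n)

module EdgeSum {n : ℕ} (G : WGraph n) where

  edgeSum-mono : ∀ {f g} → (∀ i j → adj G i j ≡ true → f i j ≤ g i j) → edgeSum G f ≤ edgeSum G g
  edgeSum-mono {f} {g} le = ΣQ-mono (λ i → ΣQ-mono (λ j → entry i j))
    where
    entry : ∀ i j → when ((toℕ i <ᵇ toℕ j) ∧ adj G i j) (f i j) ≤ when ((toℕ i <ᵇ toℕ j) ∧ adj G i j) (g i j)
    entry i j with toℕ i <ᵇ toℕ j | adj G i j in e
    ... | true  | true  = le i j e
    ... | true  | false = ℚₚ.≤-refl
    ... | false | _     = ℚₚ.≤-refl

  edgeSum-cong : ∀ {f g} → (∀ i j → adj G i j ≡ true → f i j ≡ g i j) → edgeSum G f ≡ edgeSum G g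
  edgeSum-cong eq = ℚₚ.≤-antisym (edgeSum-mono (λ i j e → ℚₚ.≤-reflexive (eq i j e)))
                                 (edgeSum-mono (λ i j e → ℚₚ.≤-reflexive (sym (eq i j e))))

  edgeSum-+ : ∀ f g → edgeSum G (λ i j → f i j + g i j) ≡ edgeSum G f + edgeSum G g
  edgeSum-+ f g = trans (ΣQ-cong (λ i → trans (ΣQ-cong (λ j → when-+ _ (f i j) (g i j))) (ΣQ-+ {n} _ _))) (ΣQ-+ {n} _ _)

  edgeSum-* : ∀ c f → edgeSum G (λ i j → c * f i j) ≡ c * edgeSum G f
  edgeSum-* c f = trans (ΣQ-cong (λ i → trans (ΣQ-cong (λ j → when-* _ c (f i j))) (ΣQ-* {n} c _))) (ΣQ-* {n} c _)

  edgeSum-ΣQ : ∀ {k} (f : Fin k → Fin n → Fin n → ℚ) →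
               edgeSum G (λ i j → ΣQ (λ γ → f γ i j)) ≡ ΣQ (λ γ → edgeSum G (f γ))
  edgeSum-ΣQ {k} f = trans
    (ΣQ-cong {n} (λ i → trans (ΣQ-cong {n} (λ j → when-ΣQ {k} _ (λ γ → f γ i j))) (ΣQ-swap {n} {k} _)))
    (ΣQ-swap {n} {k} _)

-- Rational arithmetic and heaviest colour classes

ι : ℕ → ℚ
ι n = ℤ.+ n / 1

-- Lets identities between values of `_/_` be checked on unnormalised fractions.
fromℚᵘ-+ : ∀ p q → fromℚᵘ p + fromℚᵘ q ≡ fromℚᵘ (p ℚᵘ.+ q)
fromℚᵘ-+ p q = ℚₚ.toℚᵘ-injective (begin
  toℚᵘ (fromℚᵘ p + fromℚᵘ q)               ≈⟨ ℚₚ.toℚᵘ-homo-+ (fromℚᵘ p) (fromℚᵘ q) ⟩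
  toℚᵘ (fromℚᵘ p) ℚᵘ.+ toℚᵘ (fromℚᵘ q)     ≈⟨ ℚᵘₚ.+-cong (ℚₚ.toℚᵘ-fromℚᵘ p) (ℚₚ.toℚᵘ-fromℚᵘ q) ⟩
  p ℚᵘ.+ q                                 ≈⟨ ℚₚ.toℚᵘ-fromℚᵘ (p ℚᵘ.+ q) ⟨
  toℚᵘ (fromℚᵘ (p ℚᵘ.+ q))                 ∎)
  where open ℚᵘₚ.≃-Reasoning

fromℚᵘ-* : ∀ p q → fromℚᵘ p * fromℚᵘ q ≡ fromℚᵘ (p ℚᵘ.* q)
fromℚᵘ-* p q = ℚₚ.toℚᵘ-injective (begin
  toℚᵘ (fromℚᵘ p * fromℚᵘ q)               ≈⟨ ℚₚ.toℚᵘ-homo-* (fromℚᵘ p) (fromℚᵘ q) ⟩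
  toℚᵘ (fromℚᵘ p) ℚᵘ.* toℚᵘ (fromℚᵘ q)     ≈⟨ ℚᵘₚ.*-cong (ℚₚ.toℚᵘ-fromℚᵘ p) (ℚₚ.toℚᵘ-fromℚᵘ q) ⟩
  p ℚᵘ.* q                                 ≈⟨ ℚₚ.toℚᵘ-fromℚᵘ (p ℚᵘ.* q) ⟨
  toℚᵘ (fromℚᵘ (p ℚᵘ.* q))                 ∎)
  where open ℚᵘₚ.≃-Reasoning

ι-+ : ∀ m n → ι (m ℕ.+ n) ≡ ι m + ι n
ι-+ m n = sym (trans (fromℚᵘ-+ (mkℚᵘ (ℤ.+ m) 0) (mkℚᵘ (ℤ.+ n) 0))
  (cong (_/ 1) (cong₂ ℤ._+_ (ℤₚ.*-identityʳ (ℤ.+ m)) (ℤₚ.*-identityʳ (ℤ.+ n)))))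

ι-* : ∀ m n → ι (m ℕ.* n) ≡ ι m * ι n
ι-* m n = sym (trans (fromℚᵘ-* (mkℚᵘ (ℤ.+ m) 0) (mkℚᵘ (ℤ.+ n) 0)) (cong (_/ 1) (sym (ℤₚ.pos-* m n))))

ι-denominator : ∀ p d → ι (suc d) * (ℤ.+ p / suc d) ≡ ι p
ι-denominator p d = trans (fromℚᵘ-* (mkℚᵘ (ℤ.+ suc d) 0) (mkℚᵘ (ℤ.+ p) d))
  (ℚₚ.fromℚᵘ-cong {mkℚᵘ (ℤ.+ suc d) 0 ℚᵘ.* mkℚᵘ (ℤ.+ p) d} {mkℚᵘ (ℤ.+ p) 0}
    (*≡* (trans (ℤₚ.*-identityʳ _) (trans (ℤₚ.*-comm (ℤ.+ suc d) (ℤ.+ p))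
      (cong (λ e → ℤ.+ p ℤ.* ℤ.+ suc e) (sym (ℕₚ.+-identityʳ d)))))))

ΣQ-const : ∀ n x → ΣQ {n} (λ _ → x) ≡ ι n * x
ΣQ-const zero    x = sym (ℚₚ.*-zeroˡ x)
ΣQ-const (suc n) x = trans (cong (x +_) (ΣQ-const n x))
  (trans (solve 2 (λ x m → x :+ m :* x := (con 1ℚ :+ m) :* x) refl x (ι n)) (cong (_* x) (sym (ι-+ 1 n))))

argmax : ∀ {k} (f : Fin (suc k) → ℚ) → ∃ λ γ → ∀ δ → f δ ≤ f γ
argmax {zero} f = zero , λ { zero → ℚₚ.≤-refl }
argmax {suc k} f with argmax (f ∘ suc)
... | γ , best with ℚₚ.≤-total (f zero) (f (suc γ))
...   | inj₁ le = suc γ , λ { zero → le ; (suc δ) → best δ }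
...   | inj₂ ge = zero , λ { zero → ℚₚ.≤-refl ; (suc δ) → ℚₚ.≤-trans (best δ) ge }

-- The `suc k` classes partition the edges, so the largest class sum is at least the average.
-- Properness is not assumed of `κ`, which allows colours pulled back from a contracted graph.
heaviestColour : ∀ {n k} (G : WGraph n) (f : Fin n → Fin n → ℚ) (κ : Fin n → Fin n → Fin (suc k)) →
                 ∃ λ γ → edgeSum G f ≤ ι (suc k) * edgeSum G (λ i j → when (does (κ i j ≟ γ)) (f i j))
heaviestColour {n} {k} G f κ with argmax (λ γ → edgeSum G (λ i j → when (does (κ i j ≟ γ)) (f i j)))
... | γ , best = γ , (begin
  edgeSum G f                                              ≡⟨ edgeSum-cong (λ i j _ → ΣQ-indicator (κ i j) (f i j)) ⟨
  edgeSum G (λ i j → ΣQ (λ δ → when (does (κ i j ≟ δ)) (f i j))) ≡⟨ edgeSum-ΣQ {suc k} (λ δ i j → when (does (κ i j ≟ δ)) (f i j)) ⟩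
  ΣQ (λ δ → class δ)                                       ≤⟨ ΣQ-mono best ⟩
  ΣQ {suc k} (λ _ → class γ)                               ≡⟨ ΣQ-const (suc k) (class γ) ⟩
  ι (suc k) * class γ                                      ∎)
  where
  open ℚₚ.≤-Reasoning
  open EdgeSum G
  class : Fin (suc k) → ℚ
  class δ = edgeSum G (λ i j → when (does (κ i j ≟ δ)) (f i j))

-- Random cuts

cons : ∀ {n} → Bool → (Fin n → Bool) → Fin (suc n) → Bool
cons b r zero    = b
cons b r (suc i) = r i

-- The expectation of `F` at a uniformly random bit vector, taken one coordinate at a time.
average : ∀ n → ((Fin n → Bool) → ℚ) → ℚ
average zero    F = F (λ ())
average (suc n) F = average n (λ r → ½ * (F (cons false r) + F (cons true r)))

½*[x+x] : ∀ x → ½ * (x + x) ≡ x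
½*[x+x] = solve 1 (λ x → con ½ :* (x :+ x) := x) refl

average-cong : ∀ n {F F′} → (∀ r → F r ≡ F′ r) → average n F ≡ average n F′
average-cong zero    eq = eq (λ ())
average-cong (suc n) eq = average-cong n (λ r → cong (½ *_) (cong₂ _+_ (eq (cons false r)) (eq (cons true r))))

average-const : ∀ n x → average n (λ _ → x) ≡ x
average-const zero    x = refl
average-const (suc n) x = trans (average-cong n (λ _ → ½*[x+x] x)) (average-const n x)

average-≤ : ∀ n {F c} → (∀ r → F r ≤ c) → average n F ≤ c
average-≤ zero    le = le (λ ())
average-≤ (suc n) {F} {c} le = average-≤ n (λ r → subst (_ ≤_) (½*[x+x] c)
  (ℚₚ.*-monoˡ-≤-nonNeg ½ (ℚₚ.+-mono-≤ (le (cons false r)) (le (cons true r)))))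

average-edgeSum : ∀ {m} (G : WGraph m) n (F : (Fin n → Bool) → Fin m → Fin m → ℚ) →
                  average n (λ r → edgeSum G (F r)) ≡ edgeSum G (λ i j → average n (λ r → F r i j))
average-edgeSum G zero    F = refl
average-edgeSum G (suc n) F = trans
  (average-cong n (λ r → sym (trans (edgeSum-* ½ _) (cong (½ *_) (edgeSum-+ _ _)))))
  (average-edgeSum G n (λ r i j → ½ * (F (cons false r) i j + F (cons true r) i j)))
  where open EdgeSum G

-- Distinct coordinates are independent, so averaging over one of them alone already makes the xor a
-- fair bit, whatever the other coordinate and the shifts `u` and `v` are.
average-xor : ∀ {n} (a b : Fin n) → a ≢ b → ∀ u v x →
              average n (λ r → when ((r a xor u) xor (r b xor v)) x) ≡ ½ * x
average-xor zero zero a≢b u v x = ⊥-elim (a≢b refl)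
average-xor {suc n} zero (suc b) _ u v x =
  trans (average-cong n (λ r → cong (½ *_) (fair u (r b xor v)))) (average-const n (½ * x))
  where
  fair : ∀ u d → when ((false xor u) xor d) x + when ((true xor u) xor d) x ≡ x
  fair true  true  = ℚₚ.+-identityˡ x
  fair true  false = ℚₚ.+-identityʳ x
  fair false true  = ℚₚ.+-identityʳ x
  fair false false = ℚₚ.+-identityˡ x
average-xor {suc n} (suc a) zero _ u v x =
  trans (average-cong n (λ r → cong (½ *_) (fair v (r a xor u)))) (average-const n (½ * x))
  where
  fair : ∀ v d → when (d xor (false xor v)) x + when (d xor (true xor v)) x ≡ x
  fair true  true  = ℚₚ.+-identityˡ x
  fair true  false = ℚₚ.+-identityʳ x
  fair false true  = ℚₚ.+-identityʳ x
  fair false false = ℚₚ.+-identityˡ x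
average-xor {suc n} (suc a) (suc b) a≢b u v x = trans (average-cong n (λ r → ½*[x+x] _))
  (average-xor a b (a≢b ∘ cong suc) u v x)

allParts-complete : ∀ n (A : Fin n → Bool) → ∃ λ A′ → A′ ∈ allParts n × (∀ i → A′ i ≡ A i)
allParts-complete zero    A = _ , here refl , λ ()
allParts-complete (suc n) A with A zero in eq | allParts-complete n (A ∘ suc)
... | false | A′ , A′∈ , same = _ , ∈-++⁺ˡ (∈-map⁺ _ A′∈) , λ { zero → sym eq ; (suc i) → same i }
... | true  | A′ , A′∈ , same = _ , ∈-++⁺ʳ _ (∈-map⁺ _ A′∈) , λ { zero → sym eq ; (suc i) → same i }

≤-foldr-⊔ : ∀ {A : Set} (f : A → ℚ) {x xs} → x ∈ xs → f x ≤ foldr _⊔_ 0ℚ (map f xs)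
≤-foldr-⊔ f (here refl) = ℚₚ.p≤p⊔q _ _
≤-foldr-⊔ f {xs = y ∷ _} (there p) = ℚₚ.≤-trans (≤-foldr-⊔ f p) (ℚₚ.p≤q⊔p (f y) _)

cutWeight≤mac : ∀ {n} (G : WGraph n) A → cutWeight G A ≤ mac G
cutWeight≤mac {n} G A with allParts-complete n A
... | A′ , A′∈ , same = subst (_≤ mac G)
  (edgeSum-cong (λ i j _ → cong₂ (λ u v → when (u xor v) (w G i j)) (same i) (same j)))
  (≤-foldr-⊔ (cutWeight G) A′∈)
  where open EdgeSum G

-- Vertex `v` is placed by `side v` xor the random bit of its block. Edges inside a block are always
-- cut, since the common bit cancels; other edges are cut with probability one half. No cut exceeds
-- `mac G`, hence neither does the mean.
blocks≤mac : ∀ {n} (G : WGraph n) (block : Fin n → Fin n) (side : Fin n → Bool) →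
             (∀ i j → adj G i j ≡ true → block i ≡ block j → side i ≢ side j) →
             ½ * (totalWeight G + edgeSum G (λ i j → when (does (block i ≟ block j)) (w G i j))) ≤ mac G
blocks≤mac {n} G block side bipartite = subst (_≤ mac G) expectation
  (average-≤ n (λ r → cutWeight≤mac G (λ v → r (block v) xor side v)))
  where
  open EdgeSum G
  within : Fin n → Fin n → ℚ
  within i j = when (does (block i ≟ block j)) (w G i j)
  split : ∀ c u v → u ≢ v → ∀ x → when ((c xor u) xor (c xor v)) x ≡ x
  split c     true  true  u≢v x = ⊥-elim (u≢v refl)
  split c     false false u≢v x = ⊥-elim (u≢v refl)
  split true  true  false _   x = refl
  split true  false true  _   x = refl
  split false true  false _   x = refl
  split false false true  _   x = refl
  entry : ∀ i j → adj G i j ≡ true →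
          average n (λ r → when ((r (block i) xor side i) xor (r (block j) xor side j)) (w G i j)) ≡
          ½ * (w G i j + within i j)
  entry i j e with block i ≟ block j
  ... | yes p rewrite sym p = trans (average-cong n (λ r → split (r (block i)) _ _ (bipartite i j e p) _))
          (trans (average-const n (w G i j)) (sym (½*[x+x] _)))
  ... | no ¬p = trans (average-xor _ _ ¬p _ _ _) (cong (½ *_) (sym (ℚₚ.+-identityʳ (w G i j))))
  expectation : average n (λ r → cutWeight G (λ v → r (block v) xor side v)) ≡
                ½ * (totalWeight G + edgeSum G within)
  expectation = trans (average-edgeSum G n _) (trans (edgeSum-cong entry)
    (trans (edgeSum-* ½ _) (cong (½ *_) (edgeSum-+ _ _))))

-- The underlying graph of a weighted graph

true≢false : true ≢ false
true≢false ()

toGraph : ∀ {n} → WGraph n → Graph n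
toGraph G = record
  { Edge        = λ i j → adj G i j ≡ true
  ; edge?       = λ i j → adj G i j Boolₚ.≟ true
  ; edge-sym    = λ {i} {j} e → trans (WGraph.sym G j i) e
  ; edge-irrefl = λ {i} e → true≢false (trans (sym e) (irrefl G i))
  }

trues : ∀ {n} → (Fin n → Bool) → List (Fin n)
trues {zero}  p = []
trues {suc n} p = if p zero then zero ∷ map suc (trues (p ∘ suc)) else map suc (trues (p ∘ suc))

length-trues : ∀ {n} (p : Fin n → Bool) → length (trues p) ≡ count p
length-trues {zero}  p = refl
length-trues {suc n} p with p zero
... | true  = cong suc (trans (length-map suc (trues (p ∘ suc))) (length-trues (p ∘ suc)))
... | false = trans (length-map suc (trues (p ∘ suc))) (length-trues (p ∘ suc))

∈-trues : ∀ {n} (p : Fin n → Bool) {i} → p i ≡ true → i ∈ trues p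
∈-trues p {zero} e rewrite e = here refl
∈-trues p {suc i} e with p zero
... | true  = there (∈-map⁺ suc (∈-trues (p ∘ suc) e))
... | false = ∈-map⁺ suc (∈-trues (p ∘ suc) e)

toGraph-degree : ∀ {n d} (G : WGraph n) → MaxDegreeAtMost G d → DegreeAtMost (toGraph G) d
toGraph-degree {d = d} G deg i =
  trues (adj G i) , subst (ℕ._≤ d) (sym (length-trues (adj G i))) (deg i) , ∈-trues (adj G i)

-- Contraction of a matching

abstract
  smaller : ∀ {n} → Fin n → Fin n → Fin n
  smaller u v with toℕ u ℕ.<? toℕ v
  ... | yes _ = u
  ... | no  _ = v

  smaller-sel : ∀ {n} (u v : Fin n) → smaller u v ≡ u ⊎ smaller u v ≡ v
  smaller-sel u v with toℕ u ℕ.<? toℕ v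
  ... | yes _ = inj₁ refl
  ... | no  _ = inj₂ refl

  smaller-comm : ∀ {n} (u v : Fin n) → smaller u v ≡ smaller v u
  smaller-comm u v with toℕ u ℕ.<? toℕ v | toℕ v ℕ.<? toℕ u
  ... | yes p | yes q = ⊥-elim (ℕₚ.<-asym p q)
  ... | yes p | no  q = refl
  ... | no  p | yes q = refl
  ... | no  p | no  q = toℕ-injective (ℕₚ.≤-antisym (ℕₚ.≮⇒≥ p) (ℕₚ.≮⇒≥ q))

-- Orbits of an involution have at most two elements, and the smaller one serves as name. This is
-- applied to the pairs of a matching and again to the pairs of those pairs.
module Representative {n : ℕ} (f : Fin n → Fin n) (f-inv : ∀ v → f (f v) ≡ v) where

  rep : Fin n → Fin n
  rep v = smaller v (f v)

  rep-choice : ∀ v → rep v ≡ v ⊎ rep v ≡ f v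
  rep-choice v = smaller-sel v (f v)

  rep-f : ∀ v → rep (f v) ≡ rep v
  rep-f v = trans (cong (smaller (f v)) (f-inv v)) (smaller-comm (f v) v)

  rep-cancel : ∀ {i j} → rep i ≡ rep j → i ≡ j ⊎ f i ≡ j
  rep-cancel {i} {j} eq with rep-choice i | rep-choice j
  ... | inj₁ p | inj₁ q = inj₁ (trans (sym p) (trans eq q))
  ... | inj₁ p | inj₂ q = inj₂ (trans (cong f (trans (sym p) (trans eq q))) (f-inv j))
  ... | inj₂ p | inj₁ q = inj₂ (trans (sym p) (trans eq q))
  ... | inj₂ p | inj₂ q = inj₁ (trans (sym (f-inv i)) (trans (cong f (trans (sym p) (trans eq q))) (f-inv j)))

module Contract {n k : ℕ} (G : WGraph n) (C : Colouring (toGraph G) k) (γ : Fin k) where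
  open Colouring C
  open Graph (toGraph G)

  mate : Fin n → Fin n
  mate = partner γ

  open Representative mate (partner-involutive γ) public

  -- The vertex set remains `Fin n`: a matched pair survives as its representative, and its other
  -- vertex becomes isolated. Parallel edges merge because only their existence is recorded.
  contracted : Graph n
  contracted = record
    { Edge        = λ a b → a ≢ b × ∃₂ λ i j → Edge i j × rep i ≡ a × rep j ≡ b
    ; edge?       = λ a b → ¬? (a ≟ b) ×-dec any? (λ i → any? (λ j → edge? i j ×-dec rep i ≟ a ×-dec rep j ≟ b))
    ; edge-sym    = λ { (a≢b , i , j , e , ri , rj) → a≢b ∘ sym , j , i , edge-sym e , rj , ri }
    ; edge-irrefl = λ { (a≢a , _) → a≢a refl }
    }

  rep⁻¹ : ∀ {i a} → rep i ≡ a → i ≡ a ⊎ i ≡ mate a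
  rep⁻¹ {i} eq with rep-choice i
  ... | inj₁ p = inj₁ (trans (sym p) eq)
  ... | inj₂ p = inj₂ (trans (sym (partner-involutive γ i)) (cong mate (trans (sym p) eq)))

  -- Each end of a matching edge has at most `d` neighbours besides the other end, and the
  -- contracted vertex inherits both lists; repetitions in them do no harm. Unmatched vertices keep
  -- their own neighbours, hence the separate hypothesis on them.
  contracted-degree : ∀ {d} → DegreeAtMost (toGraph G) (suc d) →
    (∀ a → mate a ≡ a → ∃ λ (ns : List (Fin n)) → length ns ℕ.≤ d ℕ.+ d × (∀ {j} → Edge a j → j ∈ ns)) →
    DegreeAtMost contracted (d ℕ.+ d)
  contracted-degree {d} deg unmatched a with partner-cases γ a
  ... | inj₁ μa≡a with unmatched a μa≡a
  ...   | ns , ns≤ , cover = map rep ns , subst (ℕ._≤ d ℕ.+ d) (sym (length-map rep ns)) ns≤ , cover′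
    where
    cover′ : ∀ {b} → Graph.Edge contracted a b → b ∈ map rep ns
    cover′ (_ , i , j , e , ri , refl) with rep⁻¹ ri
    ... | inj₁ refl = ∈-map⁺ rep (cover e)
    ... | inj₂ refl = ∈-map⁺ rep (cover (subst (λ v → Edge v j) μa≡a e))
  contracted-degree {d} deg unmatched a | inj₂ (e₀ , _) with deg a | deg (mate a)
  ... | ns , ns≤ , cover | ms , ms≤ , cover′ =
    map rep (ns′ ++ ms′) , short , both
    where
    ns′ = filter (λ v → ¬? (v ≟ mate a)) ns
    ms′ = filter (λ v → ¬? (v ≟ a)) ms
    remove-one : ∀ {x vs} → x ∈ vs → length vs ℕ.≤ suc d → length (filter (λ v → ¬? (v ≟ x)) vs) ℕ.≤ d
    remove-one {x} {vs} x∈ vs≤ = ℕ.s≤s⁻¹ (ℕₚ.<-≤-trans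
      (filter-notAll (λ v → ¬? (v ≟ x)) vs (Any.map (λ { refl ¬p → ¬p refl }) x∈)) vs≤)
    short : length (map rep (ns′ ++ ms′)) ℕ.≤ d ℕ.+ d
    short rewrite length-map rep (ns′ ++ ms′) | length-++ ns′ {ms′} =
      ℕₚ.+-mono-≤ (remove-one (cover e₀) ns≤) (remove-one (cover′ (edge-sym e₀)) ms≤)
    both : ∀ {b} → Graph.Edge contracted a b → b ∈ map rep (ns′ ++ ms′)
    both (a≢b , i , j , e , ri , refl) with rep⁻¹ ri
    ... | inj₁ refl = ∈-map⁺ rep (∈-++⁺ˡ (∈-filter⁺ _ (cover e)
            λ { refl → a≢b (trans (sym ri) (sym (rep-f i))) }))
    ... | inj₂ refl = ∈-map⁺ rep (∈-++⁺ʳ ns′ (∈-filter⁺ _ (cover′ e)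
            λ { refl → a≢b (trans (sym ri) (rep-f j)) }))

  -- Bipartite blocks from joined matching edges

  module Blocks (triangle-free : TriangleFree G) {l : ℕ} (D : Colouring contracted l) (δ : Fin l) where

    module Outer = Representative (Colouring.partner D δ) (Colouring.partner-involutive D δ)

    block : Fin n → Fin n
    block v = Outer.rep (rep v)

    edge-to-mate : ∀ {i} → mate i ≢ i → Edge i (mate i)
    edge-to-mate {i} ne with partner-cases γ i
    ... | inj₁ eq      = ⊥-elim (ne eq)
    ... | inj₂ (e , _) = e

    mate-edge : ∀ {i} → i ≢ rep i → Edge i (rep i)
    mate-edge {i} i≢ with rep-choice i
    ... | inj₁ p = ⊥-elim (i≢ (sym p))
    ... | inj₂ p = subst (Edge i) (sym p) (edge-to-mate (λ fixed → i≢ (sym (trans p fixed))))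

    mate-rep : ∀ {i} → i ≢ rep i → mate (rep i) ≡ i
    mate-rep {i} i≢ with rep-choice i
    ... | inj₁ p = ⊥-elim (i≢ (sym p))
    ... | inj₂ p = trans (cong mate p) (partner-involutive γ i)

    -- Meant for representatives `p` and `q`: some edge joins ends of the same kind. If `p` is
    -- unmatched, then `mate p` is `p` itself, and an edge from it to a true `mate q` is a crossing
    -- one; the two inequalities exclude this.
    Parallel : Fin n → Fin n → Set
    Parallel p q = Edge p q ⊎ (mate p ≢ p × mate q ≢ q × Edge (mate p) (mate q))

    abstract
      parallel? : ∀ p q → Dec (Parallel p q)
      parallel? p q = edge? p q ⊎-dec (¬? (mate p ≟ p) ×-dec ¬? (mate q ≟ q) ×-dec edge? (mate p) (mate q))

    base : Fin n → Bool
    base v = not (does (v ≟ rep v))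

    -- The second matching edge of a block is flipped when it is joined to the first one by parallel edges;
    -- parallel and crossing edges cannot both occur, as they would form a triangle.
    flipped : Fin n → Bool
    flipped q = not (does (q ≟ Outer.rep q)) ∧ does (parallel? (Outer.rep q) q)

    side : Fin n → Bool
    side v = base v xor flipped (rep v)

    cross : ∀ i j → Edge i j → base i ≢ base j xor does (parallel? (rep i) (rep j))
    cross i j e with i ≟ rep i | j ≟ rep j | parallel? (rep i) (rep j)
    ... | yes p | yes q | yes x = λ ()
    ... | yes p | yes q | no ¬x = ⊥-elim (¬x (inj₁ (subst₂ Edge p q e)))
    ... | yes p | no  q | no ¬x = λ ()
    -- A crossing edge shares one end with any parallel edge, and their other ends are matched to
    -- each other, which closes a triangle.
    ... | yes p | no  q | yes (inj₁ e′) =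
      ⊥-elim (triangle-free i j (rep j) (e , mate-edge q , edge-sym (subst (λ v → Edge v (rep j)) (sym p) e′)))
    ... | yes p | no  q | yes (inj₂ (p′ , q′ , e′)) = ⊥-elim (triangle-free i j (mate i)
      (e , edge-sym (subst₂ Edge (cong mate (sym p)) (mate-rep q) e′)
         , edge-sym (edge-to-mate (λ eq → p′ (trans (cong mate (sym p)) (trans eq p))))))
    cross i j e | no p | yes q | no ¬x = λ ()
    cross i j e | no p | yes q | yes (inj₁ e′) =
      ⊥-elim (triangle-free i j (rep i) (e , edge-sym (subst (Edge (rep i)) (sym q) e′) , edge-sym (mate-edge p)))
    cross i j e | no p | yes q | yes (inj₂ (p′ , q′ , e′)) = ⊥-elim (triangle-free i j (mate j)
      (e , edge-to-mate (λ eq → q′ (trans (cong mate (sym q)) (trans eq q)))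
         , edge-sym (subst₂ Edge (mate-rep p) (cong mate (sym q)) e′)))
    cross i j e | no p | no q | yes x = λ ()
    cross i j e | no p | no q | no ¬x = ⊥-elim (¬x (inj₂
      ( (λ eq → p (trans (sym (mate-rep p)) eq))
      , (λ eq → q (trans (sym (mate-rep q)) eq))
      , subst₂ Edge (sym (mate-rep p)) (sym (mate-rep q)) e)))

    base-differs : ∀ i j → i ≢ j → rep i ≡ rep j → base i ≢ base j
    base-differs i j i≢j eq with i ≟ rep i | j ≟ rep j
    ... | yes p | yes q = ⊥-elim (i≢j (trans p (trans eq (sym q))))
    ... | yes _ | no  _ = λ ()
    ... | no  _ | yes _ = λ ()
    ... | no  p | no  q = ⊥-elim (i≢j (trans (sym (mate-rep p)) (trans (cong mate eq) (mate-rep q))))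

    side-first : ∀ v → rep v ≡ block v → side v ≡ base v
    side-first v eq rewrite dec-true (rep v ≟ block v) eq = Boolₚ.xor-identityʳ (base v)

    side-second : ∀ v {p} → block v ≡ p → rep v ≢ p → side v ≡ base v xor does (parallel? p (rep v))
    side-second v refl ne rewrite dec-false (rep v ≟ block v) ne = refl

    xor-cancelʳ : ∀ c {a b} → a xor c ≡ b xor c → a ≡ b
    xor-cancelʳ c {a} {b} eq = trans (sym (twice a)) (trans (cong (_xor c) eq) (twice b))
      where
      twice : ∀ x → (x xor c) xor c ≡ x
      twice x = trans (Boolₚ.xor-assoc x c c) (trans (cong (x xor_) (Boolₚ.xor-same c)) (Boolₚ.xor-identityʳ x))

    -- Ends in the same pair receive the same flip and differ in `base`. Otherwise they lie in the
    -- two pairs of a block; the pair naming the block is not flipped, and the flip of the other is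
    -- the one that `cross` accounts for.
    bipartite : ∀ i j → Edge i j → block i ≡ block j → side i ≢ side j
    bipartite i j e same with rep i ≟ rep j
    ... | yes r≡ = λ eq → base-differs i j (λ { refl → edge-irrefl e }) r≡
              (xor-cancelʳ (flipped (rep i)) (trans eq (cong (λ r → base j xor flipped r) (sym r≡))))
    ... | no r≢ with Outer.rep-choice (rep i) | Outer.rep-cancel same
    ...   | _      | inj₁ r≡ = ⊥-elim (r≢ r≡)
    ...   | inj₁ p | inj₂ _ = λ eq → cross i j e (trans (sym (side-first i (sym p)))
              (trans eq (side-second j (trans (sym same) p) (r≢ ∘ sym))))
    ...   | inj₂ p | inj₂ q = λ eq → cross j i (edge-sym e)
              (trans (sym (side-first j (trans (sym q) (trans (sym p) same))))
                (trans (sym eq) (side-second i (trans p q) r≢)))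

    matching : Fin n → Fin n → ℚ
    matching i j = when (does (colour i j ≟ γ)) (w G i j)

    rest : Fin n → Fin n → ℚ
    rest i j = when (not (does (colour i j ≟ γ))) (w G i j)

    -- An edge outside the matching takes the colour of the edge it becomes after contraction.
    joined : Fin n → Fin n → ℚ
    joined i j = when (does (Colouring.colour D (rep i) (rep j) ≟ δ)) (rest i j)

    open EdgeSum G

    matching+rest : totalWeight G ≡ edgeSum G matching + edgeSum G rest
    matching+rest = trans (edgeSum-cong (λ i j _ → split (does (colour i j ≟ γ)) (w G i j))) (edgeSum-+ matching rest)
      where
      split : ∀ b x → x ≡ when b x + when (not b) x
      split true  x = sym (ℚₚ.+-identityʳ x)
      split false x = sym (ℚₚ.+-identityˡ x)

    -- Adjacent vertices with a common representative are mates, joined in colour `γ`; so all other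
    -- edges survive the contraction.
    unmatched⇒distinct-reps : ∀ {i j} → Edge i j → colour i j ≢ γ → rep i ≢ rep j
    unmatched⇒distinct-reps {i} e ¬c eq with rep-cancel eq
    ... | inj₁ refl = edge-irrefl e
    ... | inj₂ refl with partner-cases γ i
    ...   | inj₁ fixed   = edge-irrefl (subst (Edge i) fixed e)
    ...   | inj₂ (_ , c) = ¬c c

    -- At most one summand is present, as `joined` is taken from `rest`. A matching edge has ends
    -- with equal `rep`, and a joined edge has representatives that are partners under `δ`; both lie
    -- inside a block.
    matching+joined≤within : ∀ i j → Edge i j →
      matching i j + joined i j ≤ when (does (block i ≟ block j)) (w G i j)
    matching+joined≤within i j e with colour i j ≟ γ | Colouring.colour D (rep i) (rep j) ≟ δ
    ... | yes c | d rewrite dec-true (block i ≟ block j)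
                     (cong Outer.rep (trans (sym (rep-f i)) (cong rep (partner-edge e c)))) =
      ℚₚ.≤-reflexive (trans (cong (w G i j +_) (when-0 (does d))) (ℚₚ.+-identityʳ _))
      where
      when-0 : ∀ b → when b 0ℚ ≡ 0ℚ
      when-0 true  = refl
      when-0 false = refl
    ... | no ¬c | yes d rewrite dec-true (block i ≟ block j)
                     (trans (sym (Outer.rep-f (rep i))) (cong Outer.rep
                       (Colouring.partner-edge D (unmatched⇒distinct-reps e ¬c , i , j , e , refl , refl) d))) =
      ℚₚ.≤-reflexive (ℚₚ.+-identityˡ _)
    -- Both summands vanish here, so nonnegativity of the weight suffices.
    ... | no ¬c | no ¬d with block i ≟ block j
    ...   | yes _ = wnonneg G i j e
    ...   | no  _ = ℚₚ.≤-refl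

    within : Fin n → Fin n → ℚ
    within i j = when (does (block i ≟ block j)) (w G i j)

    matching+joined≤mac : ½ * (totalWeight G + (edgeSum G matching + edgeSum G joined)) ≤ mac G
    matching+joined≤mac = ℚₚ.≤-trans
      (ℚₚ.*-monoˡ-≤-nonNeg ½ (ℚₚ.+-monoʳ-≤ (totalWeight G)
        (subst (_≤ edgeSum G within) (edgeSum-+ matching joined) (edgeSum-mono matching+joined≤within))))
      (blocks≤mac G block side bipartite)

-- The arithmetic of the constant

ι-nonNeg : ∀ n → ℚ.NonNegative (ι n)
ι-nonNeg n = ℚₚ.normalize-nonNeg n 1

abstract
  -- Here `a`, `b`, `z` stand for Δ + 1, 2Δ - 1, 2Δ - 2, and `m`, `F`, `e` for the weights of the
  -- matching, of the rest and of the joined edges. Multiplied by `N`, the claim reduces to `key`,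
  -- the sum of z W ≤ z a m and a W ≤ a m + a b e. The bound on the matching carries the factor `z`
  -- so that it is trivial for Δ = 1.
  tDelta-arithmetic : ∀ {N c a b z W m F e} → .{{ℚ.Positive N}} → .{{ℚ.NonNegative a}} →
    N ≡ (1ℚ + 1ℚ) * (b * a) → N * c ≡ a + z → b ≡ 1ℚ + z →
    W ≡ m + F → z * W ≤ z * (a * m) → F ≤ b * e → (½ + c) * W ≤ ½ * (W + (m + e))
  tDelta-arithmetic {N} {c} {a} {b} {z} {W} {m} {F} {e} N≡ Nc≡ b≡ W≡ W≤ F≤ = ℚₚ.*-cancelˡ-≤-pos N scaled
    where
    open ℚₚ.≤-Reasoning
    key : (a + z) * W ≤ (b * a) * (m + e)
    key = begin
      (a + z) * W                    ≡⟨ ℚₚ.*-distribʳ-+ W a z ⟩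
      a * W + z * W                  ≤⟨ ℚₚ.+-monoʳ-≤ (a * W) W≤ ⟩
      a * W + z * (a * m)            ≡⟨ cong (λ x → a * x + z * (a * m)) W≡ ⟩
      a * (m + F) + z * (a * m)      ≡⟨ cong (_+ z * (a * m)) (ℚₚ.*-distribˡ-+ a m F) ⟩
      (a * m + a * F) + z * (a * m)  ≤⟨ ℚₚ.+-monoˡ-≤ (z * (a * m)) (ℚₚ.+-monoʳ-≤ (a * m) (ℚₚ.*-monoˡ-≤-nonNeg a F≤)) ⟩
      (a * m + a * (b * e)) + z * (a * m) ≡⟨ solve 5 (λ a b z m e →
        (a :* m :+ a :* (b :* e)) :+ z :* (a :* m) := ((con 1ℚ :+ z) :* a) :* m :+ (b :* a) :* e) refl a b z m e ⟩
      ((1ℚ + z) * a) * m + (b * a) * e ≡⟨ cong (λ x → (x * a) * m + (b * a) * e) b≡ ⟨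
      (b * a) * m + (b * a) * e      ≡⟨ ℚₚ.*-distribˡ-+ (b * a) m e ⟨
      (b * a) * (m + e)              ∎
    scaled : N * ((½ + c) * W) ≤ N * (½ * (W + (m + e)))
    scaled = begin
      N * ((½ + c) * W)            ≡⟨ solve 3 (λ n c w → n :* ((con ½ :+ c) :* w) := n :* (con ½ :* w) :+ (n :* c) :* w) refl N c W ⟩
      N * (½ * W) + (N * c) * W    ≡⟨ cong (λ x → N * (½ * W) + x * W) Nc≡ ⟩
      N * (½ * W) + (a + z) * W    ≤⟨ ℚₚ.+-monoʳ-≤ (N * (½ * W)) key ⟩
      N * (½ * W) + (b * a) * (m + e) ≡⟨ cong (N * (½ * W) +_) (solve 2 (λ p x →
        p :* x := ((con 1ℚ :+ con 1ℚ) :* p) :* (con ½ :* x)) refl (b * a) (m + e)) ⟩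
      N * (½ * W) + ((1ℚ + 1ℚ) * (b * a)) * (½ * (m + e)) ≡⟨ cong (λ x → N * (½ * W) + x * (½ * (m + e))) N≡ ⟨
      N * (½ * W) + N * (½ * (m + e)) ≡⟨ solve 3 (λ n w x →
        n :* (con ½ :* w) :+ n :* (con ½ :* x) := n :* (con ½ :* (w :+ x))) refl N W (m + e) ⟩
      N * (½ * (W + (m + e)))      ∎

0*-≤ : ∀ x y → 0ℚ * x ≤ 0ℚ * y
0*-≤ x y = ℚₚ.≤-reflexive (trans (ℚₚ.*-zeroˡ x) (sym (ℚₚ.*-zeroˡ y)))

tDelta-numerator : ∀ k → 3 ℕ.* suc k ℕ.∸ 1 ≡ (2 ℕ.+ k) ℕ.+ (k ℕ.+ k)
tDelta-numerator = ℕ-Solver.solve 1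
  -- The left side is what `3 * suc k ∸ 1` computes to: the subtraction removes the first successor.
  (λ k → k ⊕ (lit 1 ⊕ k ⊕ (lit 1 ⊕ k ⊕ lit 0)) ⊜ (lit 2 ⊕ k) ⊕ (k ⊕ k)) refl

tDelta-denominator : ∀ k → suc (4 ℕ.* k ℕ.* k ℕ.+ 10 ℕ.* k ℕ.+ 3) ≡ 2 ℕ.* (suc (k ℕ.+ k) ℕ.* (2 ℕ.+ k))
tDelta-denominator = ℕ-Solver.solve 1
  (λ k → lit 1 ⊕ (lit 4 ⊗ k ⊗ k ⊕ lit 10 ⊗ k ⊕ lit 3) ⊜ lit 2 ⊗ ((lit 1 ⊕ (k ⊕ k)) ⊗ (lit 2 ⊕ k))) refl

tDelta-bound : ∀ k {W m F e} → W ≡ m + F → ι (k ℕ.+ k) * W ≤ ι (k ℕ.+ k) * (ι (2 ℕ.+ k) * m) →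
               F ≤ ι (suc (k ℕ.+ k)) * e → tDelta (suc k) * W ≤ ½ * (W + (m + e))
tDelta-bound k = tDelta-arithmetic {{ℚₚ.normalize-pos (suc d) 1}} {{ι-nonNeg (2 ℕ.+ k)}} N≡ Nc≡ (ι-+ 1 (k ℕ.+ k))
  where
  d = 4 ℕ.* k ℕ.* k ℕ.+ 10 ℕ.* k ℕ.+ 3
  N≡ : ι (suc d) ≡ (1ℚ + 1ℚ) * (ι (suc (k ℕ.+ k)) * ι (2 ℕ.+ k))
  N≡ = trans (cong ι (tDelta-denominator k)) (trans (ι-* 2 (suc (k ℕ.+ k) ℕ.* (2 ℕ.+ k)))
         (cong ((1ℚ + 1ℚ) *_) (ι-* (suc (k ℕ.+ k)) (2 ℕ.+ k))))
  Nc≡ : ι (suc d) * (ℤ.+ (3 ℕ.* suc k ℕ.∸ 1) / suc d) ≡ ι (2 ℕ.+ k) + ι (k ℕ.+ k)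
  Nc≡ = trans (ι-denominator (3 ℕ.* suc k ℕ.∸ 1) d) (trans (cong ι (tDelta-numerator k)) (ι-+ (2 ℕ.+ k) (k ℕ.+ k)))

-- The bound on the maximum cut

module _ {n : ℕ} (k : ℕ) (G : WGraph n) (triangle-free : TriangleFree G)
         (deg : DegreeAtMost (toGraph G) (suc k)) where

  -- Shared by Δ = 1 and Δ ≥ 2, which differ in the colouring that supplies the matching and in the
  -- reason why unmatched vertices have at most 2Δ - 2 neighbours.
  tDelta≤mac : ∀ {q} (C : Colouring (toGraph G) q) γ →
    ι (k ℕ.+ k) * totalWeight G ≤
      ι (k ℕ.+ k) * (ι (2 ℕ.+ k) * edgeSum G (λ i j → when (does (Colouring.colour C i j ≟ γ)) (w G i j))) →
    (∀ a → Colouring.partner C γ a ≡ a →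
       ∃ λ (ns : List (Fin n)) → length ns ℕ.≤ k ℕ.+ k × (∀ {j} → adj G a j ≡ true → j ∈ ns)) →
    tDelta (suc k) * totalWeight G ≤ mac G
  tDelta≤mac C γ heavy unmatched = finish (heaviestColour G rest λ i j → Colouring.colour D (rep i) (rep j))
    where
    open Contract G C γ
    D : Colouring contracted (suc (k ℕ.+ k))
    D = vizing contracted (contracted-degree deg unmatched)
    rest : Fin n → Fin n → ℚ
    rest i j = when (not (does (Colouring.colour C i j ≟ γ))) (w G i j)
    finish : (∃ λ δ → edgeSum G rest ≤ ι (suc (k ℕ.+ k)) *
                edgeSum G (λ i j → when (does (Colouring.colour D (rep i) (rep j) ≟ δ)) (rest i j))) →
             tDelta (suc k) * totalWeight G ≤ mac G
    finish (δ , joined-heavy) = ℚₚ.≤-trans (tDelta-bound k matching+rest heavy joined-heavy) matching+joined≤mac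
      where open Blocks triangle-free D δ using (matching+rest; matching+joined≤mac)

singleColour : ∀ {n} (H : Graph n) → DegreeAtMost H 1 → Colouring H 1
singleColour H deg = record
  { colour     = λ _ _ → zero
  ; colour-sym = λ _ → refl
  ; proper     = λ {i} e e′ _ → unique (proj₁ (deg i)) (proj₁ (proj₂ (deg i))) (proj₂ (proj₂ (deg i)) e) (proj₂ (proj₂ (deg i)) e′)
  }
  where
  unique : ∀ {A : Set} {x y : A} xs → length xs ℕ.≤ 1 → x ∈ xs → y ∈ xs → x ≡ y
  unique (_ ∷ []) _ (here refl) (here refl) = refl
  unique (_ ∷ _ ∷ _) (s≤s ()) _ _

theorem5p12 : (Δ : ℕ) → .{{_ : NonZero Δ}} → (n : ℕ) → (G : WGraph n) → Connected G → TriangleFree G → MaxDegreeAtMost G Δ → tDelta Δ * totalWeight G ≤ mac G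
-- For Δ = 1 the bound Δ+1 on the number of colours is too weak: here the whole graph is the matching.
theorem5p12 (suc zero) n G _ triangle-free Δ≤ =
  tDelta≤mac 0 G triangle-free deg C zero
    (0*-≤ (totalWeight G) (ι 2 * edgeSum G (λ i j → when (does (Colouring.colour C i j ≟ zero)) (w G i j))))
    -- With a single colour, a vertex outside the matching has no edge at all.
    (λ a fixed → [] , z≤n , λ {j} e → ⊥-elim (Graph.edge-irrefl (toGraph G)
      (subst (λ v → adj G v j ≡ true) (trans (sym fixed) (Colouring.partner-edge C e refl)) e)))
  where
  deg = toGraph-degree G Δ≤
  C = singleColour (toGraph G) deg
theorem5p12 (suc (suc k)) n G _ triangle-free Δ≤ = finish (heaviestColour G (w G) (Colouring.colour C))
  where
  deg = toGraph-degree G Δ≤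
  C : Colouring (toGraph G) (3 ℕ.+ k)
  C = vizing (toGraph G) deg
  finish : (∃ λ γ → totalWeight G ≤ ι (3 ℕ.+ k) *
              edgeSum G (λ i j → when (does (Colouring.colour C i j ≟ γ)) (w G i j))) →
           tDelta (2 ℕ.+ k) * totalWeight G ≤ mac G
  finish (γ , heavy) = tDelta≤mac (suc k) G triangle-free deg C γ
    (ℚₚ.*-monoˡ-≤-nonNeg (ι (suc k ℕ.+ suc k)) {{ι-nonNeg (suc k ℕ.+ suc k)}} heavy)
    -- Here Δ = k + 2, so Δ ≤ 2Δ - 2 and the degree bound itself serves for unmatched vertices.
    (λ a _ → let (ns , ns≤ , cover) = deg a in
       ns , ℕₚ.≤-trans ns≤ (s≤s (ℕₚ.m≤n+m (suc k) k)) , cover)
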